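{- For every $k\in\mathbb N$, $k\ge 1$: $\mathrm C_{\sharp\le k+1}\not\le_{\mathrm W}\mathrm{Sort}_k$.
   Context: A represented space $\mathbf X$ is a set $X$ with a partial surjection $\delta_{\mathbf X}:\subseteq\mathbb N^{\mathbb N}\to X$ (a $p$ with $\delta_{\mathbf X}(p)=x$ is a name of $x$). A realizer of a (partial) multivalued function $f:\subseteq\mathbf X\rightrightarrows\mathbf Y$ is a partial $F:\subseteq\mathbb N^{\mathbb N}\to\mathbb N^{\mathbb N}$ with $\delta_{\mathbf Y}(F(p))\in f(\delta_{\mathbf X}(p))$ for all names $p$ of points of $\mathrm{dom}(f)$; write $F\vdash f$. Weihrauch reducibility: $f\le_{\mathrm W}g$ iff there are computable $H,K:\subseteq\mathbb N^{\mathbb N}\to\mathbb N^{\mathbb N}$ such that $(p\mapsto K\langle p,GH(p)\rangle)\vdash f$ for every $G\vdash g$. $\mathcal A(\mathbf X)$ is the represented space of closed subsets of $\mathbf X$ with negative information: a name of $A$ is a name of the open set $X\setminus A$ (its continuous characteristic function into Sierpiński space). For $\mathbf X=\{0,1\}^{\mathbb N}$ one may equivalently represent $A$ by a binary tree $T$ whose set of infinite paths is $A$. Closed choice $\mathrm C_{\mathbf X}:\subseteq\mathcal A(\mathbf X)\rightrightarrows\mathbf X$ maps a non-empty closed set $A$ to an arbitrary point of $A$. $\mathrm C_{\sharp\le n}$ is the restriction of $\mathrm C_{\{0,1\}^{\mathbb N}}$ to closed sets $A$ with $1\le|A|\le n$. $\mathrm{Sort}_d:\{0,\dots,d-1\}^\omega\to\{0,\dots,d-1\}^\omega$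 is defined by $\mathrm{Sort}_d(p)=0^{c_0}1^{c_1}\cdots(m-1)^{c_{m-1}}m^{\infty}$, where $m$ is the least symbol occurring infinitely often in $p$ and $c_l=|\{n: p(n)=l\}|$ for $l<m$. -}

module Defs where

open import Level using (Level; 0ℓ) renaming (suc to lsuc; _⊔_ to _⊔ˡ_)
open import Data.Bool.Base using (Bool; T; if_then_else_)
open import Data.Fin.Base using (Fin; Fin′; toℕ; inject)
open import Data.Fin.Patterns using (0F; 1F)
open import Data.Fin.Properties using (toℕ-injective)
open import Data.List.Base using (List; []; _∷_; _++_; applyUpTo; concat; replicate; tabulate)
open import Data.Nat.Base using (ℕ; zero; suc; _+_; _≤_; _<_)
open import Data.Nat.Binary.Base using (ℕᵇ; 2[1+_]; 1+[2_]; fromℕ) renaming (zero to 0ᵇ; toℕ to ℕᵇ→ℕ)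
open import Data.Nat.Binary.Properties using (fromℕ-toℕ)
open import Data.Product.Base using (Σ; ∃; ∃-syntax; _×_; _,_; proj₁; proj₂)
open import Data.Vec.Base using (Vec; []; _∷_; lookup)
open import Data.Vec.Relation.Binary.Pointwise.Inductive using (Pointwise)
open import Function.Base using (_∘_)
open import Function.Bundles using (Bijection)
open import Relation.Binary.Bundles using (Setoid)
open import Relation.Binary.PropositionalEquality
  using (_≡_; _≗_; refl; sym; trans; cong; cong₂; subst; _→-setoid_) renaming (setoid to ≡-setoid)
import Relation.Binary.Construct.On as On
open import Relation.Nullary using (¬_)
open import Relation.Unary using (Pred; _≐_)
open import Relation.Unary.Properties using (≐-refl; ≐-sym; ≐-trans)

infix 4 _⊩_·_⇓_ _⊢_ _≤W_
infix 5 _⇉_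
infixr 5 _++ω_

private variable
  a b c d ℓ : Level

Baire : Set
Baire = ℕ → ℕ

-- ⟨p , q⟩ = p(0) q(0) p(1) q(1) …
⟨_,_⟩ : Baire → Baire → Baire
⟨ p , q ⟩ zero    = p zero
⟨ p , q ⟩ (suc n) = ⟨ q , p ∘ suc ⟩ n

⟨,⟩-cong : ∀ {p p′ q q′} → p ≗ p′ → q ≗ q′ → ⟨ p , q ⟩ ≗ ⟨ p′ , q′ ⟩
⟨,⟩-cong p≗p′ q≗q′ zero    = p≗p′ zero
⟨,⟩-cong p≗p′ q≗q′ (suc n) = ⟨,⟩-cong q≗q′ (p≗p′ ∘ suc) n

-- A graph, rather than a function on a domain, so that realizers need not
-- be given by Agda functions.
record PartialFun : Set₁ where
  field
    graph      : Baire → Baire → Set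
    resp       : ∀ {p p′ q q′} → p ≗ p′ → q ≗ q′ → graph p q → graph p′ q′
    functional : ∀ {p q q′} → graph p q → graph p q′ → q ≗ q′

open PartialFun public

-- Partial recursive functions relative to an oracle p : ℕ → ℕ.
data Prog : ℕ → Set where
  zeroᴾ   : Prog 0
  sucᴾ    : Prog 1
  oracleᴾ : Prog 1
  projᴾ   : ∀ {n} → Fin n → Prog n
  compᴾ   : ∀ {m n} → Prog m → Vec (Prog n) m → Prog n
  precᴾ   : ∀ {n} → Prog n → Prog (2 + n) → Prog (1 + n)
  muᴾ     : ∀ {n} → Prog (1 + n) → Prog n

-- p ⊩ e · xs ⇓ y : with oracle p, program e halts on xs with value y.
data _⊩_·_⇓_ (p : Baire) : ∀ {n} → Prog n → Vec ℕ n → ℕ → Set where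
  ⇓zero   : p ⊩ zeroᴾ · [] ⇓ 0
  ⇓suc    : ∀ {x} → p ⊩ sucᴾ · x ∷ [] ⇓ suc x
  ⇓oracle : ∀ {x} → p ⊩ oracleᴾ · x ∷ [] ⇓ p x
  ⇓proj   : ∀ {n} {xs : Vec ℕ n} i → p ⊩ projᴾ i · xs ⇓ lookup xs i
  ⇓comp   : ∀ {m n} {e : Prog m} {es : Vec (Prog n) m} {xs ys z} →
            Pointwise (λ e′ y → p ⊩ e′ · xs ⇓ y) es ys →
            p ⊩ e · ys ⇓ z → p ⊩ compᴾ e es · xs ⇓ z
  ⇓prec₀  : ∀ {n} {e : Prog n} {e′ xs z} →
            p ⊩ e · xs ⇓ z → p ⊩ precᴾ e e′ · 0 ∷ xs ⇓ z
  ⇓precₛ  : ∀ {n} {e : Prog n} {e′ x xs y z} →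
            p ⊩ precᴾ e e′ · x ∷ xs ⇓ y →
            p ⊩ e′ · x ∷ y ∷ xs ⇓ z → p ⊩ precᴾ e e′ · suc x ∷ xs ⇓ z
  ⇓mu     : ∀ {n} {e : Prog (1 + n)} {xs y} →
            (∀ x → x < y → ∃[ z ] p ⊩ e · x ∷ xs ⇓ suc z) →
            p ⊩ e · y ∷ xs ⇓ 0 → p ⊩ muᴾ e · xs ⇓ y

-- Restrictions of computable functions count as computable; this makes no
-- difference to ≤W below.
Computable : PartialFun → Set
Computable F = Σ (Prog 1) λ e → ∀ p q → graph F p q → ∀ n → p ⊩ e · n ∷ [] ⇓ q n

record RepresentedSpace c : Set (lsuc c) where
  field
    space : Setoid c 0ℓ
  open Setoid space public using (Carrier; _≈_)
  field
    δ        : Baire → Carrier → Set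
    δ-resp   : ∀ {p q x y} → p ≗ q → x ≈ y → δ p x → δ q y
    δ-unique : ∀ {p x y} → δ p x → δ p y → x ≈ y
    δ-surj   : ∀ x → ∃[ p ] δ p x

open RepresentedSpace using (Carrier; δ)

-- Partial multivalued functions X ⇉ Y; y ∈ f(x) is  rel f x y.
record _⇉_ (X : RepresentedSpace a) (Y : RepresentedSpace b) : Set (lsuc 0ℓ ⊔ˡ a ⊔ˡ b) where
  private
    module X = RepresentedSpace X
    module Y = RepresentedSpace Y
  field
    rel      : X.Carrier → Y.Carrier → Set
    rel-resp : ∀ {x x′ y y′} → x X.≈ x′ → y Y.≈ y′ → rel x y → rel x′ y′

  dom : X.Carrier → Set b
  dom x = ∃[ y ] rel x y

open _⇉_ public using (rel; dom)

_⊢_ : {X : RepresentedSpace a} {Y : RepresentedSpace b} → PartialFun → X ⇉ Y → Set (a ⊔ˡ b)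
_⊢_ {X = X} {Y = Y} F f =
  ∀ p x → δ X p x → dom f x → ∃[ q ] graph F p q × ∃[ y ] δ Y q y × rel f x y

-- p ↦ K⟨p, G H(p)⟩
K⟨id,_∘_⟩ : (G H : PartialFun) → PartialFun → PartialFun
K⟨id, G ∘ H ⟩ K = record
  { graph      = λ p r → ∃[ q ] ∃[ s ] graph H p q × graph G q s × graph K ⟨ p , s ⟩ r
  ; resp       = λ p≗ r≗ (q , s , h , g , k) →
      q , s , resp H p≗ (λ _ → refl) h , g , resp K (⟨,⟩-cong p≗ (λ _ → refl)) r≗ k
  ; functional = λ (_ , _ , h , g , k) (_ , _ , h′ , g′ , k′) →
      let s≗ = functional G (resp G (functional H h h′) (λ _ → refl) g) g′
      in functional K (resp K (⟨,⟩-cong (λ _ → refl) s≗) (λ _ → refl) k) k′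
  }

_≤W_ : {X : RepresentedSpace a} {Y : RepresentedSpace b}
       {Z : RepresentedSpace c} {W : RepresentedSpace d} →
       X ⇉ Y → Z ⇉ W → Set (lsuc 0ℓ ⊔ˡ a ⊔ˡ b ⊔ˡ c ⊔ˡ d)
f ≤W g = ∃[ H ] ∃[ K ] Computable H × Computable K ×
         (∀ G → G ⊢ g → K⟨id, G ∘ H ⟩ K ⊢ f)

-- The subset A of S has exactly n elements.
HasCard : (S : Setoid c 0ℓ) → Pred (Setoid.Carrier S) 0ℓ → ℕ → Set c
HasCard S A n = Bijection (≡-setoid (Fin n)) (On.setoid {B = ∃ A} S proj₁)

HasCard-resp : ∀ (S : Setoid c 0ℓ) {A B n} → A ≐ B → HasCard S A n → HasCard S B n
HasCard-resp S (A⊆B , B⊆A) β = record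
  { to        = λ i → proj₁ (to i) , A⊆B (proj₂ (to i))
  ; cong      = β.cong
  ; bijective = β.injective , λ (x , x∈B) → β.surjective (x , B⊆A x∈B)
  }
  where
  module β = Bijection β
  open β using (to)

-- {0,…,d-1}^ω
Seq : ℕ → RepresentedSpace 0ℓ
Seq d = record
  { space    = ℕ →-setoid Fin d
  ; δ        = λ p x → p ≗ toℕ ∘ x
  ; δ-resp   = λ p≗q x≗y p≗x n → trans (sym (p≗q n)) (trans (p≗x n) (cong toℕ (x≗y n)))
  ; δ-unique = λ p≗x p≗y n → toℕ-injective (trans (sym (p≗x n)) (p≗y n))
  ; δ-surj   = λ x → toℕ ∘ x , λ _ → refl
  }

Cantor : RepresentedSpace 0ℓ
Cantor = Seq 2

Word : Set
Word = List (Fin 2)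

record Tree : Set where
  field
    member        : Word → Bool
    prefix-closed : ∀ u v → T (member (u ++ v)) → T (member u)

open Tree public

Paths : Tree → Pred (ℕ → Fin 2) 0ℓ
Paths t x = ∀ n → T (member t (applyUpTo x n))

bits : Word → ℕᵇ
bits []       = 0ᵇ
bits (0F ∷ w) = 1+[2 bits w ]
bits (1F ∷ w) = 2[1+ bits w ]

-- A bijection between binary words and ℕ.
code : Word → ℕ
code w = ℕᵇ→ℕ (bits w)

Codes : Baire → Tree → Set
Codes p t = ∀ w → p (code w) ≡ (if member t w then 1 else 0)

record ClosedSet : Set₁ where
  field
    points : Pred (ℕ → Fin 2) 0ℓ
    closed : ∃[ t ] Paths t ≐ points

open ClosedSet public

unbits : ℕᵇ → Word
unbits 0ᵇ       = []
unbits 2[1+ n ] = 1F ∷ unbits n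
unbits 1+[2 n ] = 0F ∷ unbits n

unbits-bits : ∀ w → unbits (bits w) ≡ w
unbits-bits []       = refl
unbits-bits (0F ∷ w) = cong (0F ∷_) (unbits-bits w)
unbits-bits (1F ∷ w) = cong (1F ∷_) (unbits-bits w)

encode : Tree → Baire
encode t n = if member t (unbits (fromℕ n)) then 1 else 0

encode-codes : ∀ t → Codes (encode t) t
encode-codes t w = cong (λ v → if member t v then 1 else 0)
  (trans (cong unbits (fromℕ-toℕ (bits w))) (unbits-bits w))

if-injective : ∀ {x y : Bool} → (if x then 1 else 0) ≡ (if y then 1 else 0) → x ≡ y
if-injective {Bool.false} {Bool.false} _ = refl
if-injective {Bool.true}  {Bool.true}  _ = refl

codes-unique : ∀ {p t t′} → Codes p t → Codes p t′ → ∀ w → member t w ≡ member t′ w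
codes-unique ct ct′ w = if-injective (trans (sym (ct w)) (ct′ w))

paths-cong : ∀ {t t′} → (∀ w → member t w ≡ member t′ w) → Paths t ≐ Paths t′
paths-cong t≗t′ = (λ x∈ n → subst T (t≗t′ _) (x∈ n)) , (λ x∈ n → subst T (sym (t≗t′ _)) (x∈ n))

applyUpTo-cong : ∀ {x y : ℕ → Fin 2} → x ≗ y → ∀ n → applyUpTo x n ≡ applyUpTo y n
applyUpTo-cong x≗y zero    = refl
applyUpTo-cong x≗y (suc n) = cong₂ _∷_ (x≗y 0) (applyUpTo-cong (x≗y ∘ suc) n)

points-resp : ∀ (A : ClosedSet) {x y} → x ≗ y → points A x → points A y
points-resp A x≗y x∈A = let (t , t⊆A , A⊆t) = closed A in
  t⊆A (λ n → subst (T ∘ member t) (applyUpTo-cong x≗y n) (A⊆t x∈A n))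

-- 𝒜({0,1}^ℕ): a name of A is the characteristic function of a binary tree
-- whose infinite paths are exactly the points of A.
𝒜Cantor : RepresentedSpace (lsuc 0ℓ)
𝒜Cantor = record
  { space    = record
      { Carrier       = ClosedSet
      ; _≈_           = λ A B → points A ≐ points B
      ; isEquivalence = record { refl = ≐-refl ; sym = ≐-sym ; trans = ≐-trans }
      }
  ; δ        = λ p A → ∃[ t ] Codes p t × Paths t ≐ points A
  ; δ-resp   = λ p≗q A≐B (t , ct , t≐A) →
      t , (λ w → trans (sym (p≗q (code w))) (ct w)) , ≐-trans t≐A A≐B
  ; δ-unique = λ {p} (t , ct , t≐A) (t′ , ct′ , t′≐B) →
      ≐-trans (≐-sym t≐A) (≐-trans (paths-cong {t} {t′} (codes-unique {p} {t} {t′} ct ct′)) t′≐B)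
  ; δ-surj   = λ A → let (t , t≐A) = closed A in encode t , t , encode-codes t , t≐A
  }

C♯≤ : ℕ → 𝒜Cantor ⇉ Cantor
C♯≤ n = record
  { rel      = λ A x → (∃[ m ] 1 ≤ m × m ≤ n × HasCard (ℕ →-setoid Fin 2) (points A) m) × points A x
  ; rel-resp = λ {_} {B} A≐B x≗y ((m , 1≤m , m≤n , card) , x∈A) →
      (m , 1≤m , m≤n , HasCard-resp (ℕ →-setoid Fin 2) A≐B card) , points-resp B x≗y (proj₁ A≐B x∈A)
  }

InfinitelyOften : ∀ {d} → Fin d → (ℕ → Fin d) → Set
InfinitelyOften l p = ∀ N → ∃[ n ] N ≤ n × p n ≡ l

_++ω_ : ∀ {A : Set a} → List A → (ℕ → A) → (ℕ → A)
([]      ++ω x) n       = x n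
((y ∷ w) ++ω x) zero    = y
((y ∷ w) ++ω x) (suc n) = (w ++ω x) n

-- Fin′ m consists of the symbols l < m; inject views them as elements of Fin d.
IsSortOf : ∀ {d} → (ℕ → Fin d) → (ℕ → Fin d) → Set
IsSortOf {d} p q = Σ (Fin d) λ m → Σ (Fin′ m → ℕ) λ c →
  InfinitelyOften m p ×
  (∀ (l : Fin′ m) → ¬ InfinitelyOften (inject l) p) ×
  (∀ (l : Fin′ m) → HasCard (≡-setoid ℕ) (λ n → p n ≡ inject l) (c l)) ×
  q ≗ (concat (tabulate λ l → replicate (c l) (inject l)) ++ω λ _ → m)

Sort : ∀ d → Seq d ⇉ Seq d
Sort d = record
  { rel      = IsSortOf
  ; rel-resp = λ p≗p′ q≗q′ (m , c , inf , least , count , q≗) →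
      m , c , io p≗p′ inf , (λ l → least l ∘ io (sym ∘ p≗p′)) ,
      (λ l → HasCard-resp (≡-setoid ℕ)
        ((λ {n} → trans (sym (p≗p′ n))) , (λ {n} → trans (p≗p′ n))) (count l)) ,
      (λ n → trans (sym (q≗q′ n)) (q≗ n))
  }
  where
  io : ∀ {p p′ : ℕ → Fin d} {l} → p ≗ p′ → InfinitelyOften l p → InfinitelyOften l p′
  io p≗p′ inf N = let (n , N≤n , eq) = inf N in n , N≤n , trans (sym (p≗p′ n)) eq

{-# OPTIONS --safe #-}

-- Call a finite tree stage with j+1 live cones j-forcing if every tree with at most k+1 paths
-- that extends it and keeps a path in each cone makes H output only symbols ≥ j from some
-- fixed position on.  A k-forcing stage with k+1 cones is absurd, since H outputs symbols < k.
-- From a j-forcing stage s one gets a (j+1)-forcing stage with one more cone.  If some stage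
-- above s with the same cones is (j+1)-forcing, split any of its cones.  Otherwise a Baire
-- category construction gives a tree with one path per cone on which H outputs j infinitely
-- often, so K commits to one of the cones after seeing finitely much.  Split that cone into
-- twins.  If no stage above this one is (j+1)-forcing, a second generic tree makes K commit to
-- one of the twins; killing that twin leaves a path in each of the original j+1 cones, so H
-- outputs no new symbol < j, the sorted sequence keeps the prefix read by K, and K is wrong.

module Submission where

open import Defs
open import Level using (0ℓ)
open import Data.Nat.Base
open import Relation.Nullary using (¬_; Dec; yes; no; contradiction; ¬?)
open import Relation.Nullary.Decidable using (T?; _×-dec_; _⊎-dec_; ⌊_⌋; toWitness; fromWitness)
open import Axiom.ExcludedMiddle using (ExcludedMiddle)
open import Data.Bool.Base using (true; false; T; if_then_else_)
open import Data.Fin.Base using (Fin; zero; suc; toℕ; inject; opposite; punchIn; punchOut)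
import Data.Fin.Properties as Fin
open import Data.Fin.Properties using (toℕ-inject; toℕ-injective; toℕ<n; injective⇒≤)
open import Data.List.Base
  using (List; []; _∷_; _++_; length; filter; concat; replicate; tabulate; applyUpTo; lookup)
open import Data.List.Properties
  using (≡-dec; length-++; length-tabulate; length-applyUpTo; ∷-injectiveˡ; ∷-injectiveʳ)
open import Data.List.Membership.Propositional.Properties using (∈-lookup)
open import Data.List.Relation.Unary.All as All using (All; []; _∷_)
import Data.List.Relation.Unary.All.Properties as All
open import Data.List.Relation.Unary.AllPairs using ([]; _∷_)
open import Data.List.Relation.Unary.Unique.Propositional using (Unique)
import Data.List.Relation.Unary.Unique.Propositional.Properties as Unique
import Data.Nat.Binary.Base as ℕᵇ
import Data.Nat.Binary.Properties as ℕᵇ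
open import Data.Nat.Properties
open import Data.Product.Base using (∃; ∃-syntax; _×_; _,_; proj₁; proj₂)
open import Data.Sum.Base using (_⊎_; inj₁; inj₂)
open import Data.Unit.Base using (tt)
open import Data.Vec.Base using (Vec; []; _∷_)
open import Data.Vec.Relation.Binary.Pointwise.Inductive using (Pointwise; []; _∷_)
open import Function.Base using (_∘_)
open import Function.Bundles using (Bijection; _⇔_; mk⇔; Equivalence)
open import Function.Properties.Equivalence using () renaming (trans to ⇔-trans; sym to ⇔-sym)
open import Relation.Binary.Definitions using (tri<; tri≈; tri>)
open import Relation.Binary.PropositionalEquality hiding (resp)
open import Relation.Unary using (Pred; Decidable; _≐_)
open import Relation.Unary.Properties using (≐-refl)

open Equivalence using (to; from)

-- Finite use of oracle computations

infix 4 _≈[_]_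

_≈[_]_ : ∀ {A : Set} → (ℕ → A) → ℕ → (ℕ → A) → Set
x ≈[ n ] y = ∀ i → i < n → x i ≡ y i

≈[]-mono : ∀ {A : Set} {x y : ℕ → A} {m n} → m ≤ n → x ≈[ n ] y → x ≈[ m ] y
≈[]-mono m≤n x≈y i i<m = x≈y i (<-≤-trans i<m m≤n)

≈[]-sym : ∀ {A : Set} {x y : ℕ → A} {n} → x ≈[ n ] y → y ≈[ n ] x
≈[]-sym x≈y i i<n = sym (x≈y i i<n)

≈[]-trans : ∀ {A : Set} {x y z : ℕ → A} {n} → x ≈[ n ] y → y ≈[ n ] z → x ≈[ n ] z
≈[]-trans x≈y y≈z i i<n = trans (x≈y i i<n) (y≈z i i<n)

⟨,⟩-≈[] : ∀ {p p′ q q′} n → p ≈[ n ] p′ → q ≈[ n ] q′ → ⟨ p , q ⟩ ≈[ n ] ⟨ p′ , q′ ⟩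
⟨,⟩-≈[] (suc n) p≈ q≈ zero    _   = p≈ 0 z<s
⟨,⟩-≈[] (suc n) p≈ q≈ (suc i) i<n =
  ⟨,⟩-≈[] n (≈[]-mono (n≤1+n n) q≈) (λ m m<n → p≈ (suc m) (s<s m<n)) i (s<s⁻¹ i<n)

uniform-bound : (Q : ℕ → ℕ → Set) → (∀ {n l l′} → l ≤ l′ → Q n l → Q n l′) →
  ∀ b → (∀ n → n < b → ∃ (Q n)) → ∃ λ l → ∀ n → n < b → Q n l
uniform-bound Q mono zero    f = 0 , λ _ ()
uniform-bound Q mono (suc b) f
  with uniform-bound Q mono b (λ n n<b → f n (m<n⇒m<1+n n<b)) | f b ≤-refl
... | l , g | l′ , q = l ⊔ l′ , h
  where
  h : ∀ n → n < suc b → Q n (l ⊔ l′)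
  h n n<1+b with m≤n⇒m<n∨m≡n (s≤s⁻¹ n<1+b)
  ... | inj₁ n<b  = mono (m≤m⊔n l l′) (g n n<b)
  ... | inj₂ refl = mono (m≤n⊔m l l′) q

deterministic : ∀ {p n} {e : Prog n} {xs y y′} → p ⊩ e · xs ⇓ y → p ⊩ e · xs ⇓ y′ → y ≡ y′
deterministic* : ∀ {p m n} {es : Vec (Prog n) m} {xs ys ys′} →
  Pointwise (λ e y → p ⊩ e · xs ⇓ y) es ys → Pointwise (λ e y → p ⊩ e · xs ⇓ y) es ys′ → ys ≡ ys′

deterministic ⇓zero ⇓zero = refl
deterministic ⇓suc ⇓suc = refl
deterministic ⇓oracle ⇓oracle = refl
deterministic (⇓proj i) (⇓proj .i) = refl
deterministic (⇓comp ds d) (⇓comp ds′ d′) with deterministic* ds ds′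
... | refl = deterministic d d′
deterministic (⇓prec₀ d) (⇓prec₀ d′) = deterministic d d′
deterministic (⇓precₛ d₁ d₂) (⇓precₛ d₁′ d₂′) with deterministic d₁ d₁′
... | refl = deterministic d₂ d₂′
-- Searches stopping at different places clash: the later one needs a successor value where the
-- earlier one found 0.
deterministic {y = y} {y′} (⇓mu f d) (⇓mu f′ d′) with <-cmp y y′
... | tri≈ _ y≡y′ _ = y≡y′
... | tri< y<y′ _ _ = contradiction (deterministic d (proj₂ (f′ y y<y′))) λ ()
... | tri> _ _ y′<y = contradiction (deterministic (proj₂ (f y′ y′<y)) d′) λ ()

deterministic* [] [] = refl
deterministic* (d ∷ ds) (d′ ∷ ds′) = cong₂ _∷_ (deterministic d d′) (deterministic* ds ds′)

-- A halting derivation is finite and only `⇓oracle` consults the oracle, so changes of the oracle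
-- beyond some `u` do no harm; bounds of subderivations are joined by maxima.
finite-use : ∀ {p n} {e : Prog n} {xs y} → p ⊩ e · xs ⇓ y →
  ∃ λ u → ∀ {p′} → p ≈[ u ] p′ → p′ ⊩ e · xs ⇓ y
finite-use* : ∀ {p m n} {es : Vec (Prog n) m} {xs ys} → Pointwise (λ e y → p ⊩ e · xs ⇓ y) es ys →
  ∃ λ u → ∀ {p′} → p ≈[ u ] p′ → Pointwise (λ e y → p′ ⊩ e · xs ⇓ y) es ys
finite-use-suc : ∀ {p n} {e : Prog n} {xs} → (∃[ z ] p ⊩ e · xs ⇓ suc z) →
  ∃ λ u → ∀ {p′} → p ≈[ u ] p′ → ∃[ z ] p′ ⊩ e · xs ⇓ suc z

finite-use ⇓zero = 0 , λ _ → ⇓zero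
finite-use ⇓suc = 0 , λ _ → ⇓suc
finite-use {p} (⇓oracle {x}) = suc x , λ {p′} p≈p′ →
  subst (λ y → p′ ⊩ oracleᴾ · x ∷ [] ⇓ y) (sym (p≈p′ x ≤-refl)) ⇓oracle
finite-use (⇓proj i) = 0 , λ _ → ⇓proj i
finite-use (⇓comp ds d) with finite-use* ds | finite-use d
... | u , f | v , g = u ⊔ v , λ p≈ →
  ⇓comp (f (≈[]-mono (m≤m⊔n u v) p≈)) (g (≈[]-mono (m≤n⊔m u v) p≈))
finite-use (⇓prec₀ d) with finite-use d
... | u , f = u , λ p≈ → ⇓prec₀ (f p≈)
finite-use (⇓precₛ d₁ d₂) with finite-use d₁ | finite-use d₂
... | u , f | v , g = u ⊔ v , λ p≈ →
  ⇓precₛ (f (≈[]-mono (m≤m⊔n u v) p≈)) (g (≈[]-mono (m≤n⊔m u v) p≈))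
finite-use {p} (⇓mu {e = e} {xs} {y} f d)
  with uniform-bound (λ x u → ∀ {p′} → p ≈[ u ] p′ → ∃[ z ] p′ ⊩ e · x ∷ xs ⇓ suc z)
         (λ u≤v f p≈ → f (≈[]-mono u≤v p≈)) y (λ x x<y → finite-use-suc (f x x<y))
     | finite-use d
... | u , g | v , h = u ⊔ v , λ p≈ →
  ⇓mu (λ x x<y → g x x<y (≈[]-mono (m≤m⊔n u v) p≈)) (h (≈[]-mono (m≤n⊔m u v) p≈))

finite-use* [] = 0 , λ _ → []
finite-use* (d ∷ ds) with finite-use d | finite-use* ds
... | u , f | v , g = u ⊔ v , λ p≈ → f (≈[]-mono (m≤m⊔n u v) p≈) ∷ g (≈[]-mono (m≤n⊔m u v) p≈)

finite-use-suc (z , d) with finite-use d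
... | u , f = u , λ p≈ → z , f p≈

-- Sorting

-- Cardinality bounds on possibly infinite sets of naturals, by duplicate-free lists of elements.
AtLeast AtMost Exactly : ℕ → Pred ℕ 0ℓ → Set
AtLeast c P = ∃ λ ns → Unique ns × All P ns × c ≤ length ns
AtMost  c P = ∀ ns → Unique ns → All P ns → length ns ≤ c
Exactly c P = AtLeast c P × AtMost c P

AtLeast-map : ∀ {c c′} {P Q : Pred ℕ 0ℓ} → c′ ≤ c → (∀ {n} → P n → Q n) → AtLeast c P → AtLeast c′ Q
AtLeast-map c′≤c P⊆Q (ns , ns! , P-ns , c≤) = ns , ns! , All.map P⊆Q P-ns , ≤-trans c′≤c c≤

Exactly-resp : ∀ {c} {P Q : Pred ℕ 0ℓ} → P ≐ Q → Exactly c P → Exactly c Q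
Exactly-resp (P⊆Q , Q⊆P) (atLeast , atMost) =
  AtLeast-map ≤-refl P⊆Q atLeast , λ ns ns! Q-ns → atMost ns ns! (All.map Q⊆P Q-ns)

lookup-injective : ∀ {ns : List ℕ} → Unique ns → ∀ i j → lookup ns i ≡ lookup ns j → i ≡ j
lookup-injective (_ ∷ _) zero zero _ = refl
lookup-injective (n∉ns ∷ _) zero (suc j) eq = contradiction eq (All.lookup n∉ns (∈-lookup j))
lookup-injective (n∉ns ∷ _) (suc i) zero eq = contradiction (sym eq) (All.lookup n∉ns (∈-lookup i))
lookup-injective (_ ∷ ns!) (suc i) (suc j) eq = cong suc (lookup-injective ns! i j eq)

-- The values of the bijection form the list for the lower bound. For the upper bound, taking
-- preimages injects the positions of a duplicate-free list into `Fin c`.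
HasCard⇒Exactly : ∀ {P : Pred ℕ 0ℓ} {c} → HasCard (setoid ℕ) P c → Exactly c P
HasCard⇒Exactly {P} {c} β =
  ( tabulate element , Unique.tabulate⁺ β.injective , All.tabulate⁺ (λ i → proj₂ (β.to i))
  , ≤-reflexive (sym (length-tabulate element)) ) , atMost
  where
  module β = Bijection β
  element : Fin c → ℕ
  element = proj₁ ∘ β.to
  atMost : AtMost c P
  atMost ns ns! P-ns = injective⇒≤ {f = index} λ {i} {j} eq →
    lookup-injective ns! i j (trans (sym (index-inverse i)) (trans (cong element eq) (index-inverse j)))
    where
    preimage : ∀ i → _
    preimage i = β.surjective (lookup ns i , All.lookup P-ns (∈-lookup i))
    index : Fin (length ns) → Fin c
    index i = proj₁ (preimage i)
    index-inverse : ∀ i → element (index i) ≡ lookup ns i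
    index-inverse i = proj₂ (preimage i) refl

-- The bound `b` makes the next witness new; it also says how long a prefix preserves all these
-- occurrences.
infinite⇒list : ∀ {P : Pred ℕ 0ℓ} → (∀ N → ∃ λ n → N ≤ n × P n) → ∀ c →
  ∃ λ b → ∃ λ ns → Unique ns × All P ns × All (_< b) ns × length ns ≡ c
infinite⇒list inf zero = 0 , [] , [] , [] , [] , refl
infinite⇒list inf (suc c) with infinite⇒list inf c
... | b , ns , ns! , P-ns , ns<b , len with inf b
... | n , b≤n , Pn =
  suc n , n ∷ ns ,
  All.map (λ m<b n≡m → <-irrefl (sym n≡m) (<-≤-trans m<b b≤n)) ns<b ∷ ns! ,
  Pn ∷ P-ns ,
  ≤-refl ∷ All.map (λ m<b → m<n⇒m<1+n (<-≤-trans m<b b≤n)) ns<b ,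
  cong suc len

length-filter-¬ : ∀ {P : Pred ℕ 0ℓ} (P? : Decidable P) ns →
  length ns ≡ length (filter P? ns) + length (filter (¬? ∘ P?) ns)
length-filter-¬ P? [] = refl
length-filter-¬ P? (n ∷ ns) with P? n
... | yes _ = cong suc (length-filter-¬ P? ns)
... | no _  = trans (cong suc (length-filter-¬ P? ns)) (sym (+-suc _ _))

<-+-suc : ∀ {y} o l → y < o + suc l ⇔ y < suc o + l
<-+-suc {y} o l = mk⇔ (subst (y <_) (+-suc o l)) (subst (y <_) (sym (+-suc o l)))

partialSum : ∀ {m} → (Fin m → ℕ) → ℕ → ℕ
partialSum {zero}  c l       = 0
partialSum {suc m} c zero    = 0
partialSum {suc m} c (suc l) = c zero + partialSum (c ∘ suc) l

InRange : (ℕ → ℕ) → ℕ → ℕ → Pred ℕ 0ℓ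
InRange x o l n = o ≤ x n × x n < o + l

-- Induction on the symbols: `c zero` counts the positions of `o`, and the rest is the same claim
-- with offset `suc o`. A filter splits any list for the range into these two disjoint parts.
exactly-partialSum : ∀ (x : ℕ → ℕ) {m} o (c : Fin m → ℕ) →
  (∀ i → Exactly (c i) (λ n → x n ≡ o + toℕ i)) → ∀ l → l ≤ m → Exactly (partialSum c l) (InRange x o l)
exactly-partialSum x {zero} o c _ zero _ = ([] , [] , [] , z≤n) , λ
  { [] _ _ → z≤n
  ; (n ∷ _) _ ((o≤ , <o) ∷ _) → contradiction (subst (x n <_) (+-identityʳ o) <o) (≤⇒≯ o≤) }
exactly-partialSum x {suc m} o c _ zero _ = ([] , [] , [] , z≤n) , λ
  { [] _ _ → z≤n
  ; (n ∷ _) _ ((o≤ , <o) ∷ _) → contradiction (subst (x n <_) (+-identityʳ o) <o) (≤⇒≯ o≤) }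
exactly-partialSum x {suc m} o c count (suc l) (s≤s l≤m)
  with subst (λ v → Exactly (c zero) (λ n → x n ≡ v)) (+-identityʳ o) (count zero)
     | exactly-partialSum x (suc o) (c ∘ suc)
         (λ i → subst (λ v → Exactly (c (suc i)) (λ n → x n ≡ v)) (+-suc o (toℕ i)) (count (suc i))) l l≤m
... | (ms , ms! , x-ms , c≤ms) , atMost₀ | (ns , ns! , x-ns , c≤ns) , atMost₁ = atLeast , atMost
  where
  atLeast : AtLeast (c zero + partialSum (c ∘ suc) l) (InRange x o (suc l))
  atLeast = ms ++ ns
    , Unique.++⁺ ms! ns! (λ (∈ms , ∈ns) →
        1+n≰n (subst (suc o ≤_) (All.lookup x-ms ∈ms) (proj₁ (All.lookup x-ns ∈ns))))
    , All.++⁺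
        (All.map (λ eq → ≤-reflexive (sym eq) , subst (_< o + suc l) (sym eq) (m<m+n o z<s)) x-ms)
        (All.map (λ (o< , <o+l) → <⇒≤ o< , from (<-+-suc o l) <o+l) x-ns)
    , subst (_ ≤_) (sym (length-++ ms)) (+-mono-≤ c≤ms c≤ns)
  atMost : AtMost (c zero + partialSum (c ∘ suc) l) (InRange x o (suc l))
  atMost ps ps! x-ps = subst (_≤ _) (sym (length-filter-¬ P? ps)) (+-mono-≤
    (atMost₀ _ (Unique.filter⁺ P? ps!) (All.all-filter P? ps))
    (atMost₁ _ (Unique.filter⁺ (¬? ∘ P?) ps!)
      (All.zipWith (λ (¬eq , (o≤ , <o+l)) →
          ≤∧≢⇒< o≤ (¬eq ∘ sym) , to (<-+-suc o l) <o+l)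
        (All.all-filter (¬? ∘ P?) ps , All.filter⁺ (¬? ∘ P?) x-ps))))
    where
    P? : Decidable (λ n → x n ≡ o)
    P? n = x n ≟ o

replicate-++ω : ∀ {A : Set} c (a : A) w (x : ℕ → A) n →
  (n < c × ((replicate c a ++ w) ++ω x) n ≡ a) ⊎
  (∃ λ n′ → n ≡ c + n′ × ((replicate c a ++ w) ++ω x) n ≡ (w ++ω x) n′)
replicate-++ω zero    a w x n    = inj₂ (n , refl , refl)
replicate-++ω (suc c) a w x zero = inj₁ (z<s , refl)
replicate-++ω (suc c) a w x (suc n) with replicate-++ω c a w x n
... | inj₁ (n<c , eq)       = inj₁ (s<s n<c , eq)
... | inj₂ (n′ , refl , eq) = inj₂ (n′ , refl , eq)

blocks : ∀ {d m} → (Fin m → Fin d) → Fin d → (Fin m → ℕ) → ℕ → Fin d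
blocks h t c = concat (tabulate λ l → replicate (c l) (h l)) ++ω λ _ → t

-- The first `l` blocks together have length `partialSum c l`, and exactly on them the symbol is
-- below `o + l`.
blocks-bounds : ∀ {d m} (h : Fin m → Fin d) t (c : Fin m → ℕ) o →
  (∀ i → toℕ (h i) ≡ o + toℕ i) → toℕ t ≡ o + m → ∀ n →
  let y = toℕ (blocks h t c n) in
  o ≤ y × y ≤ o + m × (∀ l → l ≤ m → y < o + l ⇔ n < partialSum c l)
blocks-bounds {m = zero} h t c o h≡ t≡ n =
  subst (o ≤_) (sym t≡) (m≤m+n o 0) , ≤-reflexive t≡ ,
  λ { zero _ → mk⇔ (λ t<o → contradiction (≤-reflexive (sym t≡)) (<⇒≱ t<o)) λ () }
blocks-bounds {m = suc m} h t c o h≡ t≡ n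
  with replicate-++ω (c zero) (h zero) (concat (tabulate λ l → replicate (c (suc l)) (h (suc l)))) (λ _ → t) n
... | inj₁ (n<c , eq) =
  ≤-reflexive (sym y≡o) , ≤-trans (≤-reflexive y≡o) (m≤m+n o (suc m)) , λ
  { zero    _ → mk⇔ (λ y<o → contradiction (≤-reflexive (sym y≡o)) (<⇒≱ (subst (_ <_) (+-identityʳ o) y<o)))
                    λ ()
  ; (suc l) _ → mk⇔ (λ _ → <-≤-trans n<c (m≤m+n _ _))
                    (λ _ → subst (_< o + suc l) (sym y≡o) (m<m+n o z<s)) }
  where
  y≡o : _
  y≡o = trans (cong toℕ eq) (trans (h≡ zero) (+-identityʳ o))
... | inj₂ (n′ , refl , eq) rewrite eq
  with blocks-bounds (h ∘ suc) t (c ∘ suc) (suc o)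
         (λ i → trans (h≡ (suc i)) (+-suc o (toℕ i))) (trans t≡ (+-suc o m)) n′
... | o<y , y≤ , iff =
  <⇒≤ o<y , ≤-trans y≤ (≤-reflexive (sym (+-suc o m))) , λ
  { zero    _ → mk⇔ (λ y<o → contradiction (subst (_ <_) (+-identityʳ o) y<o) (≤⇒≯ (<⇒≤ o<y)))
                    λ ()
  ; (suc l) (s≤s l≤m) → mk⇔
      (λ y<o+l → +-monoʳ-< (c zero) (to (iff l l≤m) (to (<-+-suc o l) y<o+l)))
      (λ n<sum → from (<-+-suc o l) (from (iff l l≤m) (+-cancelˡ-< (c zero) _ _ n<sum))) }

-- Describes the output by counts alone, without the limit symbol. For `l` up to that symbol the
-- count is a sum of block lengths; for larger `l` both sides always hold, as the limit symbol
-- occurs infinitely often.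
sort-spec : ∀ {d} {x y : ℕ → Fin d} → IsSortOf x y → ∀ n l →
  toℕ (y n) < l ⇔ AtLeast (suc n) (λ i → toℕ (x i) < l)
sort-spec {d} {x} {y} (m , c , inf , _ , count , y≗) n l
  rewrite y≗ n with blocks-bounds inject m c 0 toℕ-inject refl n
... | _ , y≤m , iff with l ≤? toℕ m
... | no l≰m = mk⇔
  (λ _ → let b , ns , ns! , x-ns , _ , len = infinite⇒list inf (suc n) in
    ns , ns! , All.map (λ eq → subst (_< l) (sym (cong toℕ eq)) (≰⇒> l≰m)) x-ns , ≤-reflexive (sym len))
  (λ _ → ≤-<-trans y≤m (≰⇒> l≰m))
... | yes l≤m = ⇔-trans (iff l l≤m) (mk⇔
  (λ n<sum → AtLeast-map n<sum proj₂ (proj₁ exactly))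
  (λ (ns , ns! , x-ns , n<) → <-≤-trans n< (proj₂ exactly ns ns! (All.map (z≤n ,_) x-ns))))
  where
  exactly : Exactly (partialSum c l) (InRange (toℕ ∘ x) 0 l)
  exactly = exactly-partialSum (toℕ ∘ x) 0 c
    (λ i → Exactly-resp
      ((λ eq → trans (cong toℕ eq) (toℕ-inject i)) , (λ eq → toℕ-injective (trans eq (sym (toℕ-inject i)))))
      (HasCard⇒Exactly (count i)))
    l l≤m

≡-by-upper-bounds : ∀ {a b} → (∀ l → a < l ⇔ b < l) → a ≡ b
≡-by-upper-bounds iff = ≤-antisym (s≤s⁻¹ (from (iff _) ≤-refl)) (s≤s⁻¹ (to (iff _) ≤-refl))

sort-unique : ∀ {d} {x x′ y y′ : ℕ → Fin d} → x ≗ x′ → IsSortOf x y → IsSortOf x′ y′ → y ≗ y′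
sort-unique x≗x′ sorted sorted′ n = toℕ-injective (≡-by-upper-bounds λ l →
  ⇔-trans (sort-spec sorted n l) (⇔-trans
    (mk⇔ (AtLeast-map ≤-refl (λ {i} → subst (λ s → toℕ s < l) (x≗x′ i)))
         (AtLeast-map ≤-refl (λ {i} → subst (λ s → toℕ s < l) (sym (x≗x′ i)))))
    (⇔-sym (sort-spec sorted′ n l))))

EventuallyAbove : ∀ {d} → ℕ → ℕ → (ℕ → Fin d) → Set
EventuallyAbove j N x = ∀ i → N ≤ i → j ≤ toℕ (x i)

-- Sorting is discontinuous in general, but not here. Symbols below `j` sit before `N`, so a prefix
-- fixes their counts, and once `B` copies of `j` have been seen, the first `B` outputs are at most
-- `j` whatever follows.
sort-continuous : ∀ {d} {x y : ℕ → Fin d} j N → EventuallyAbove j N x →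
  (∀ M → ∃ λ i → M ≤ i × toℕ (x i) ≡ j) → IsSortOf x y → ∀ B →
  ∃ λ M → ∀ {x′ y′} → x ≈[ M ] x′ → EventuallyAbove j N x′ → IsSortOf x′ y′ → y ≈[ B ] y′
sort-continuous {x = x} {y} j N above inf sorted B with infinite⇒list inf B
... | b , ns , ns! , x-ns , ns<b , len = N ⊔ b , agree
  where
  below : ∀ {x x′ : ℕ → Fin _} {n l} → x ≈[ N ⊔ b ] x′ → EventuallyAbove j N x → l ≤ j →
    AtLeast n (λ i → toℕ (x i) < l) → AtLeast n (λ i → toℕ (x′ i) < l)
  below x≈ above l≤j = AtLeast-map ≤-refl λ {i} xi<l →
    subst (λ s → toℕ s < _)
      (x≈ i (<-≤-trans (≰⇒> λ N≤i → <⇒≱ (<-≤-trans xi<l l≤j) (above i N≤i)) (m≤m⊔n N b))) xi<l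

  many : ∀ {x′ n l} → x ≈[ N ⊔ b ] x′ → n < B → j < l → AtLeast (suc n) (λ i → toℕ (x′ i) < l)
  many x≈ n<B j<l = ns , ns!
    , All.zipWith (λ {i} (eq , i<b) →
        subst (_< _) (trans (sym eq) (cong toℕ (x≈ i (<-≤-trans i<b (m≤n⊔m N b))))) j<l) (x-ns , ns<b)
    , ≤-trans n<B (≤-reflexive (sym len))

  agree : ∀ {x′ y′} → x ≈[ N ⊔ b ] x′ → EventuallyAbove j N x′ → IsSortOf x′ y′ → y ≈[ B ] y′
  agree {x′} x≈ above′ sorted′ n n<B = toℕ-injective (≡-by-upper-bounds λ l →
    ⇔-trans (sort-spec sorted n l) (⇔-trans (counts l) (⇔-sym (sort-spec sorted′ n l))))
    where
    counts : ∀ l → AtLeast (suc n) (λ i → toℕ (x i) < l) ⇔ AtLeast (suc n) (λ i → toℕ (x′ i) < l)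
    counts l with l ≤? j
    ... | yes l≤j = mk⇔ (below x≈ above l≤j) (below (λ i i<M → sym (x≈ i i<M)) above′ l≤j)
    ... | no l≰j  = mk⇔ (λ _ → many x≈ n<B (≰⇒> l≰j)) (λ _ → many (λ _ _ → refl) n<B (≰⇒> l≰j))

-- Trees with finitely many paths

Point : Set
Point = ℕ → Fin 2

infix 8 _↾_

_↾_ : Point → ℕ → Word
_↾_ = applyUpTo

↾-cong : ∀ {x y} n → x ≈[ n ] y → x ↾ n ≡ y ↾ n
↾-cong zero    x≈y = refl
↾-cong (suc n) x≈y = cong₂ _∷_ (x≈y 0 z<s) (↾-cong n λ i i<n → x≈y (suc i) (s<s i<n))

↾-injective : ∀ {x y} n → x ↾ n ≡ y ↾ n → x ≈[ n ] y
↾-injective (suc n) eq zero    _   = ∷-injectiveˡ eq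
↾-injective (suc n) eq (suc i) i<n = ↾-injective n (∷-injectiveʳ eq) i (s<s⁻¹ i<n)

↾-+ : ∀ x m n → x ↾ (m + n) ≡ x ↾ m ++ (x ∘ (m +_)) ↾ n
↾-+ x zero    n = refl
↾-+ x (suc m) n = cong (x 0 ∷_) (↾-+ (x ∘ suc) m n)

prefix-of-↾ : ∀ x u {v n} → u ++ v ≡ x ↾ n → u ≡ x ↾ length u
prefix-of-↾ x []      eq = refl
prefix-of-↾ x (a ∷ u) {n = suc n} eq =
  cong₂ _∷_ (∷-injectiveˡ eq) (prefix-of-↾ (x ∘ suc) u (∷-injectiveʳ eq))

infix 4 _∈[_]_ _≈ᵗ[_]_

_∈[_]_ : Point → ℕ → Tree → Set
x ∈[ n ] t = T (member t (x ↾ n))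

∈[]-down : ∀ t {x m n} → m ≤ n → x ∈[ n ] t → x ∈[ m ] t
∈[]-down t {x} {m} {n} m≤n x∈ = prefix-closed t (x ↾ m) ((x ∘ (m +_)) ↾ (n ∸ m))
  (subst (T ∘ member t) (trans (cong (x ↾_) (sym (m+[n∸m]≡n m≤n))) (↾-+ x m (n ∸ m))) x∈)

∈[]-resp : ∀ t {x y n} → x ≈[ n ] y → x ∈[ n ] t → y ∈[ n ] t
∈[]-resp t {n = n} x≈y = subst (T ∘ member t) (↾-cong n x≈y)

record _≈ᵗ[_]_ (t : Tree) (n : ℕ) (t′ : Tree) : Set where
  constructor agreeing
  field
    agrees : ∀ w → length w ≤ n → member t w ≡ member t′ w

open _≈ᵗ[_]_ public

≈ᵗ-mono : ∀ {t t′ m n} → m ≤ n → t ≈ᵗ[ n ] t′ → t ≈ᵗ[ m ] t′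
≈ᵗ-mono m≤n t≈t′ = agreeing λ w w≤ → agrees t≈t′ w (≤-trans w≤ m≤n)

≈ᵗ-refl : ∀ {t n} → t ≈ᵗ[ n ] t
≈ᵗ-refl = agreeing λ _ _ → refl

≈ᵗ-sym : ∀ {t t′ n} → t ≈ᵗ[ n ] t′ → t′ ≈ᵗ[ n ] t
≈ᵗ-sym t≈t′ = agreeing λ w w≤ → sym (agrees t≈t′ w w≤)

≈ᵗ-trans : ∀ {t t′ t″ n} → t ≈ᵗ[ n ] t′ → t′ ≈ᵗ[ n ] t″ → t ≈ᵗ[ n ] t″
≈ᵗ-trans t≈t′ t′≈t″ = agreeing λ w w≤ → trans (agrees t≈t′ w w≤) (agrees t′≈t″ w w≤)

∈[]-≈ᵗ : ∀ {t t′ x m n} → t ≈ᵗ[ n ] t′ → m ≤ n → x ∈[ m ] t → x ∈[ m ] t′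
∈[]-≈ᵗ {x = x} {m} t≈t′ m≤n = subst T (agrees t≈t′ (x ↾ m) (≤-trans (≤-reflexive (length-applyUpTo x m)) m≤n))

length-unbits : ∀ b → length (unbits b) ≤ ℕᵇ.toℕ b
length-unbits ℕᵇ.zero = z≤n
length-unbits ℕᵇ.2[1+ b ] = ≤-trans (s≤s (length-unbits b)) (m≤n*m _ 2)
length-unbits ℕᵇ.1+[2 b ] = s≤s (≤-trans (length-unbits b) (m≤n*m _ 2))

-- A word is no longer than its code, so the first `n` entries of the name concern only words of
-- length at most `n`.
encode-≈[] : ∀ {t t′} n → t ≈ᵗ[ n ] t′ → encode t ≈[ n ] encode t′
encode-≈[] n t≈t′ i i<n = cong (if_then 1 else 0) (agrees t≈t′ (unbits (ℕᵇ.fromℕ i))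
  (≤-trans (length-unbits (ℕᵇ.fromℕ i)) (≤-trans (≤-reflexive (ℕᵇ.toℕ-fromℕ i)) (<⇒≤ i<n))))

T-ext : ∀ {a b} → (T a → T b) → (T b → T a) → a ≡ b
T-ext {false} {false} _ _ = refl
T-ext {false} {true}  _ g with () ← g _
T-ext {true}  {false} f _ with () ← f _
T-ext {true}  {true}  _ _ = refl

Separated : ∀ {m} → ℕ → (Fin m → Point) → Set
Separated n xs = ∀ {i j} → xs i ≈[ n ] xs j → i ≡ j

record Enumerates {m} (t : Tree) (xs : Fin m → Point) : Set where
  field
    sound    : ∀ i → Paths t (xs i)
    complete : ∀ {z} → Paths t z → ∃ λ i → z ≗ xs i
    distinct : ∀ {i j} → xs i ≗ xs j → i ≡ j

open Enumerates public

enumerates⇒HasCard : ∀ {m t} {xs : Fin m → Point} → Enumerates t xs → HasCard (ℕ →-setoid Fin 2) (Paths t) m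
enumerates⇒HasCard {xs = xs} e = record
  { to        = λ i → xs i , sound e i
  ; cong      = λ { refl _ → refl }
  ; bijective = distinct e , λ (z , z∈) → let i , z≗ = complete e z∈ in
      i , λ { refl n → sym (z≗ n) }
  }

SizeWithin : ℕ → Tree → Set
SizeWithin K t = ∃ λ m → ∃ λ (xs : Fin m → Point) → 1 ≤ m × m ≤ K × Enumerates t xs

-- Only node i ↾ level matters, not the rest of node i, and only the members of tree up to level.
record Stage (m : ℕ) : Set where
  field
    tree      : Tree
    level     : ℕ
    node      : Fin m → Point
    node∈     : ∀ i → node i ∈[ level ] tree
    separated : Separated level node
    clean     : ∀ {z} → z ∈[ level ] tree → ∃ λ i → z ≈[ level ] node i

open Stage public

-- Trees above a stage, and the order of stages

infix 4 _⊑_ _≼_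

-- A cone may hold several paths of `t`, so a tree with paths through split cones still lies above
-- the unsplit stage.
_⊑_ : ∀ {m} → Stage m → Tree → Set
s ⊑ t = tree s ≈ᵗ[ level s ] t × ∀ i → ∃ λ x → Paths t x × x ≈[ level s ] node s i

record _≼_ {m} (s s′ : Stage m) : Set where
  field
    level-≤ : level s ≤ level s′
    tree-≈  : tree s ≈ᵗ[ level s ] tree s′
    node-≈  : ∀ i → node s′ i ≈[ level s ] node s i

open _≼_ public

≼-refl : ∀ {m} {s : Stage m} → s ≼ s
≼-refl = record { level-≤ = ≤-refl ; tree-≈ = ≈ᵗ-refl ; node-≈ = λ _ _ _ → refl }

≼-trans : ∀ {m} {s s′ s″ : Stage m} → s ≼ s′ → s′ ≼ s″ → s ≼ s″
≼-trans p q = record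
  { level-≤ = ≤-trans (level-≤ p) (level-≤ q)
  ; tree-≈  = ≈ᵗ-trans (tree-≈ p) (≈ᵗ-mono (level-≤ p) (tree-≈ q))
  ; node-≈  = λ i n n< → trans (node-≈ q i n (<-≤-trans n< (level-≤ p))) (node-≈ p i n n<)
  }

≼-⊑ : ∀ {m} {s s′ : Stage m} {t} → s ≼ s′ → s′ ⊑ t → s ⊑ t
≼-⊑ p (s′≈t , through) =
  ≈ᵗ-trans (tree-≈ p) (≈ᵗ-mono (level-≤ p) s′≈t) ,
  λ i → let x , x∈ , x≈ = through i in
    x , x∈ , λ n n< → trans (x≈ n (<-≤-trans n< (level-≤ p))) (node-≈ p i n n<)

-- Cuts `D` at depth `L` and lets only the points `xs` continue, so these are all the paths.
-- Separation is asked only at depth `suc L`, which allows twins that first differ at bit `L`.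
module Graft {m} (D : Tree) (L : ℕ) (xs : Fin m → Point)
             (xs∈ : ∀ i → xs i ∈[ L ] D) (sep : Separated (suc L) xs) where

  Member : Word → Set
  Member w = (length w ≤ L × T (member D w)) ⊎ (L < length w × ∃ λ i → w ≡ xs i ↾ length w)

  member? : Decidable Member
  member? w = (length w ≤? L ×-dec T? (member D w))
    ⊎-dec (L <? length w ×-dec Fin.any? λ i → ≡-dec Fin._≟_ w (xs i ↾ length w))

  Member-closed : ∀ u v → Member (u ++ v) → Member u
  Member-closed u v (inj₁ (≤L , uv∈)) =
    inj₁ (≤-trans (subst (length u ≤_) (sym (length-++ u)) (m≤m+n _ _)) ≤L , prefix-closed D u v uv∈)
  Member-closed u v (inj₂ (L< , i , eq)) with length u ≤? L
  ... | yes ≤L = inj₁ (≤L , subst (T ∘ member D) (sym (prefix-of-↾ (xs i) u eq)) (∈[]-down D ≤L (xs∈ i)))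
  ... | no ≰L  = inj₂ (≰⇒> ≰L , i , prefix-of-↾ (xs i) u eq)

  graft : Tree
  graft = record
    { member        = λ w → ⌊ member? w ⌋
    ; prefix-closed = λ u v uv∈ → fromWitness (Member-closed u v (toWitness uv∈))
    }

  graft-≈ : D ≈ᵗ[ L ] graft
  graft-≈ = agreeing λ w w≤L → T-ext (λ w∈ → fromWitness (inj₁ (w≤L , w∈))) (D-member w≤L ∘ toWitness)
    where
    D-member : ∀ {w} → length w ≤ L → Member w → T (member D w)
    D-member _   (inj₁ (_ , w∈))  = w∈
    D-member w≤L (inj₂ (L<w , _)) = contradiction w≤L (<⇒≱ L<w)

  xs∈graft : ∀ i → Paths graft (xs i)
  xs∈graft i n with n ≤? L
  ... | yes n≤L = ∈[]-≈ᵗ {x = xs i} graft-≈ n≤L (∈[]-down D n≤L (xs∈ i))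
  ... | no n≰L  = fromWitness (inj₂
    ( subst (L <_) (sym (length-applyUpTo (xs i) n)) (≰⇒> n≰L)
    , i , cong (xs i ↾_) (sym (length-applyUpTo (xs i) n)) ))

  beyond : ∀ {z n} → L < n → z ∈[ n ] graft → ∃ λ i → z ≈[ n ] xs i
  beyond {z} {n} L<n z∈ with toWitness {a? = member? (z ↾ n)} z∈
  ... | inj₁ (n≤L , _) = contradiction (subst (_≤ L) (length-applyUpTo z n) n≤L) (<⇒≱ L<n)
  ... | inj₂ (_ , i , eq) = i , ↾-injective n (trans eq (cong (xs i ↾_) (length-applyUpTo z n)))

  graft-enumerates : Enumerates graft xs
  graft-enumerates = record
    { sound    = xs∈graft
    ; complete = complete-graft
    ; distinct = λ eq → sep λ n _ → eq n
    }
    where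
    complete-graft : ∀ {z} → Paths graft z → ∃ λ i → z ≗ xs i
    complete-graft {z} z∈ with beyond ≤-refl (z∈ (suc L))
    ... | i , z≈ = i , z≗
      where
      z≗ : z ≗ xs i
      -- The index found at this depth might vary with `n`, but prefixes of length `suc L` already
      -- determine it.
      z≗ n with beyond {z} {suc (n ⊔ L)} (s≤s (m≤n⊔m n L)) (z∈ _)
      ... | i′ , z≈′
        with sep {i} {i′} (λ p p< → trans (sym (z≈ p p<)) (≈[]-mono (s≤s (m≤n⊔m n L)) z≈′ p p<))
      ... | refl = z≈′ n (s≤s (m≤m⊔n n L))

  stage : Stage m
  stage = record
    { tree      = graft
    -- At depth `suc L` the nodes of `D` off the grafted points are gone, which gives `clean`, and
    -- the points are separated.
    ; level     = suc L
    ; node      = xs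
    ; node∈     = λ i → xs∈graft i (suc L)
    ; separated = sep
    ; clean     = beyond ≤-refl
    }

  stage-≈ : ∀ {t} → stage ⊑ t → D ≈ᵗ[ L ] t
  stage-≈ (graft≈t , _) = ≈ᵗ-trans graft-≈ (≈ᵗ-mono (n≤1+n L) graft≈t)

-- Limits of increasing stages

module Limit {m} (s : ℕ → Stage m) (increasing : ∀ r → s r ≼ s (suc r))
             (level-< : ∀ r → level (s r) < level (s (suc r))) (1≤m : 1 ≤ m) where

  s-mono : ∀ {q r} → q ≤ r → s q ≼ s r
  s-mono {q} q≤r = go (≤⇒≤′ q≤r)
    where
    go : ∀ {r} → q ≤′ r → s q ≼ s r
    go ≤′-refl       = ≼-refl
    go (≤′-step q≤r) = ≼-trans (go q≤r) (increasing _)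

  r≤level : ∀ r → r ≤ level (s r)
  r≤level zero    = z≤n
  r≤level (suc r) = ≤-<-trans (r≤level r) (level-< r)

  member-stable : ∀ {q r} w → length w ≤ level (s q) → length w ≤ level (s r) →
    member (tree (s q)) w ≡ member (tree (s r)) w
  member-stable {q} {r} w w≤q w≤r with ≤-total q r
  ... | inj₁ q≤r = agrees (tree-≈ (s-mono q≤r)) w w≤q
  ... | inj₂ r≤q = sym (agrees (tree-≈ (s-mono r≤q)) w w≤r)

  -- Levels grow strictly, so stage number `length w` has already decided `w`, and no later stage
  -- revises the decision.
  limit : Tree
  limit = record
    { member        = λ w → member (tree (s (length w))) w
    ; prefix-closed = λ u v uv∈ →
        subst T (member-stable u
          (≤-trans (subst (length u ≤_) (sym (length-++ u)) (m≤m+n _ _)) (r≤level (length (u ++ v))))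
          (r≤level (length u)))
        (prefix-closed (tree (s (length (u ++ v)))) u v uv∈)
    }

  limit-≈ : ∀ r → tree (s r) ≈ᵗ[ level (s r) ] limit
  limit-≈ r = agreeing λ w w≤ → member-stable w w≤ (r≤level (length w))

  branch : Fin m → Point
  branch i n = node (s (suc n)) i n

  branch-≈ : ∀ r i → branch i ≈[ level (s r) ] node (s r) i
  branch-≈ r i n n< with ≤-total r (suc n)
  ... | inj₁ r≤ = node-≈ (s-mono r≤) i n n<
  ... | inj₂ ≤r = sym (node-≈ (s-mono ≤r) i n (r≤level (suc n)))

  branch∈ : ∀ i → Paths limit (branch i)
  branch∈ i n = ∈[]-down limit {branch i} (r≤level n) (∈[]-≈ᵗ {x = branch i} (limit-≈ n) ≤-refl
    (∈[]-resp (tree (s n)) (λ p p< → sym (branch-≈ n i p p<)) (node∈ (s n) i)))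

  branch-separated : Separated (level (s 0)) branch
  branch-separated {i} {j} eq = separated (s 0) λ n n< →
    trans (sym (branch-≈ 0 i n n<)) (trans (eq n n<) (branch-≈ 0 j n n<))

  on-branch : ∀ {z} → Paths limit z → ∀ r → ∃ λ i → z ≈[ level (s r) ] branch i
  on-branch {z} z∈ r
    with clean (s r) (∈[]-≈ᵗ {x = z} (≈ᵗ-sym (limit-≈ r)) ≤-refl (z∈ (level (s r))))
  ... | i , z≈ = i , λ n n< → trans (z≈ n n<) (sym (branch-≈ r i n n<))

  -- By `clean`, a path follows some branch up to every level; since stage 0 separates the branches,
  -- it is always the same one.
  limit-enumerates : Enumerates limit branch
  limit-enumerates = record
    { sound    = branch∈
    ; complete = complete-limit
    ; distinct = λ eq → branch-separated λ n _ → eq n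
    }
    where
    complete-limit : ∀ {z} → Paths limit z → ∃ λ i → z ≗ branch i
    complete-limit {z} z∈ with on-branch z∈ 0
    ... | i , z≈ = i , z≗
      where
      z≗ : z ≗ branch i
      z≗ n with on-branch z∈ (suc n)
      ... | i′ , z≈′
        with branch-separated {i} {i′} (λ p p< →
               trans (sym (z≈ p p<)) (≈[]-mono (level-≤ (s-mono {0} {suc n} z≤n)) z≈′ p p<))
      ... | refl = z≈′ n (r≤level (suc n))

  limit-⊒ : ∀ r → s r ⊑ limit
  limit-⊒ r = limit-≈ r , λ i → branch i , branch∈ i , branch-≈ r i

-- Splitting and killing cones

opposite-≢ : (b : Fin 2) → opposite b ≢ b
opposite-≢ zero       ()
opposite-≢ (suc zero) ()

twin : Point → ℕ → Point
twin x n i with i ≟ n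
... | yes _ = opposite (x i)
... | no _  = x i

twin-≈ : ∀ x n → twin x n ≈[ n ] x
twin-≈ x n i i<n with i ≟ n
... | yes i≡n = contradiction i≡n (<⇒≢ i<n)
... | no _    = refl

twin-≢ : ∀ x n → twin x n n ≢ x n
twin-≢ x n with n ≟ n
... | yes _  = opposite-≢ (x n)
... | no n≢n = contradiction refl n≢n

-- The new twin of `i` has index `zero` and an old cone `j` becomes `suc j`, so `zero` and `suc i`
-- are the twins over `i`.
parent : ∀ {m} → Fin m → Fin (suc m) → Fin m
parent i zero    = i
parent i (suc j) = j

split : ∀ {m} → (Fin m → Point) → Fin m → ℕ → Fin (suc m) → Point
split xs i n zero    = twin (xs i) n
split xs i n (suc j) = xs j

split-≈ : ∀ {m} (xs : Fin m → Point) i n a → split xs i n a ≈[ n ] xs (parent i a)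
split-≈ xs i n zero    = twin-≈ (xs i) n
split-≈ xs i n (suc j) = λ _ _ → refl

split-separated : ∀ {m} {xs : Fin m → Point} i {n} → Separated n xs → Separated (suc n) (split xs i n)
split-separated {xs = xs} i {n} sep = go _ _
  where
  twin-apart : ∀ j → ¬ twin (xs i) n ≈[ suc n ] xs j
  twin-apart j eq with sep (≈[]-trans (≈[]-sym (twin-≈ (xs i) n)) (≈[]-mono (n≤1+n n) eq))
  ... | refl = twin-≢ (xs i) n (eq n ≤-refl)

  go : ∀ a b → split xs i n a ≈[ suc n ] split xs i n b → a ≡ b
  go zero    zero    _  = refl
  go zero    (suc j) eq = contradiction eq (twin-apart j)
  go (suc j) zero    eq = contradiction (≈[]-sym eq) (twin-apart j)
  go (suc j) (suc l) eq = cong suc (sep (≈[]-mono (n≤1+n n) eq))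

-- The other twin still represents the cone `i`. If `b` is `suc j`, then `j` is `i` and `zero`
-- survives; otherwise `suc j` itself survives.
removing-twin-covers : ∀ {m} (i : Fin m) b → parent i b ≡ i → ∀ j → ∃ λ e → parent i (punchIn b e) ≡ j
removing-twin-covers i b b↦i j with b Fin.≟ suc j
... | yes refl = punchOut {i = suc j} {zero} (λ ()) ,
  trans (cong (parent i) (Fin.punchIn-punchOut {i = suc j} {zero} λ ())) (sym b↦i)
... | no b≢j   = punchOut b≢j , cong (parent i) (Fin.punchIn-punchOut b≢j)

full : Tree
full = record { member = λ _ → true ; prefix-closed = λ _ _ _ → tt }

module _ {m m′} (s : Stage m) (D : Tree) {L} {xs : Fin m′ → Point}
         {xs∈ : ∀ i → xs i ∈[ L ] D} {sep : Separated (suc L) xs}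
         (tree-≈ : tree s ≈ᵗ[ level s ] D) (level≤L : level s ≤ L)
         (cover : ∀ i → ∃ λ e → xs e ≈[ level s ] node s i) where

  open Graft D L xs xs∈ sep

  -- It is enough that each cone of `s` receives a grafted point, so the same argument serves
  -- splitting a cone and killing a twin.
  graft-stage-⊑ : ∀ {t} → stage ⊑ t → s ⊑ t
  graft-stage-⊑ stage⊑t =
    ≈ᵗ-trans tree-≈ (≈ᵗ-mono level≤L (stage-≈ stage⊑t)) , λ i →
    let e , xs≈ = cover i
        x , x∈ , x≈ = proj₂ stage⊑t e
    in x , x∈ , ≈[]-trans (≈[]-mono (≤-trans level≤L (n≤1+n L)) x≈) xs≈

  ⊑-graft : s ⊑ graft
  ⊑-graft = graft-stage-⊑ (≈ᵗ-refl , λ e → xs e , xs∈graft e , λ _ _ → refl)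

-- A realizer of sorting

sortFun : ℕ → PartialFun
sortFun d = record
  -- The limit symbol is part of the data of `IsSortOf`, so no function has to find it.
  { graph      = λ p q → ∃ λ x → ∃ λ y → p ≗ toℕ ∘ x × IsSortOf {d} x y × q ≗ toℕ ∘ y
  ; resp       = λ p≗ q≗ (x , y , p≗x , sorted , q≗y) →
      x , y , (λ n → trans (sym (p≗ n)) (p≗x n)) , sorted , λ n → trans (sym (q≗ n)) (q≗y n)
  ; functional = λ (x , y , p≗x , sorted , q≗y) (x′ , y′ , p≗x′ , sorted′ , q′≗y′) n →
      trans (q≗y n) (trans
        (cong toℕ (sort-unique (λ i → toℕ-injective (trans (sym (p≗x i)) (p≗x′ i))) sorted sorted′ n))
        (sym (q′≗y′ n)))
  }

sortFun⊢Sort : ∀ d → sortFun d ⊢ Sort d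
sortFun⊢Sort d p x p≗x (y , sorted) =
  toℕ ∘ y , (x , y , p≗x , sorted , λ _ → refl) , y , (λ _ → refl) , sorted

-- Forcing the outputs of a supposed reduction

module Reduction (em : ExcludedMiddle 0ℓ) (k : ℕ) (H K : PartialFun)
                 (H-computable : Computable H) (K-computable : Computable K)
                 (reduces : K⟨id, sortFun k ∘ H ⟩ K ⊢ C♯≤ (k + 1)) where

  eᴴ eᴷ : Prog 1
  eᴴ = proj₁ H-computable
  eᴷ = proj₁ K-computable

  Outputs : Tree → ℕ → ℕ → Set
  Outputs t i v = encode t ⊩ eᴴ · i ∷ [] ⇓ v

  record Run (t : Tree) : Set where
    field
      input       : ℕ → Fin k
      sorted      : ℕ → Fin k
      answer      : Point
      input-runs  : ∀ n → Outputs t n (toℕ (input n))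
      isSort      : IsSortOf input sorted
      answer-runs : ∀ n → ⟨ encode t , toℕ ∘ sorted ⟩ ⊩ eᴷ · n ∷ [] ⇓ toℕ (answer n)
      answer∈     : Paths t answer

  open Run

  abstract
    run : ∀ {t} → SizeWithin (k + 1) t → Run t
    run {t} (m , xs , 1≤m , m≤K , e)
      with reduces (encode t) A (t , encode-codes t , ≐-refl)
             (xs (first 1≤m) , size , sound e (first 1≤m))
      where
      A : ClosedSet
      A = record { points = Paths t ; closed = t , ≐-refl }
      size : ∃ λ n → 1 ≤ n × n ≤ k + 1 × HasCard (ℕ →-setoid Fin 2) (Paths t) n
      size = m , 1≤m , m≤K , enumerates⇒HasCard e
      first : ∀ {m} → 1 ≤ m → Fin m
      first (s≤s _) = zero
    ... | r , (q , s , Hpq , (x , y , q≗x , isSort , s≗y) , Kr) , z , r≗z , _ , z∈ = record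
      { input       = x
      ; sorted      = y
      ; answer      = z
      ; input-runs  = proj₂ H-computable _ _ (resp H (λ _ → refl) q≗x Hpq)
      ; isSort      = isSort
      ; answer-runs = proj₂ K-computable _ _ (resp K (⟨,⟩-cong (λ _ → refl) s≗y) r≗z Kr)
      ; answer∈     = z∈
      }

  -- `N` does not depend on `t`; this uniformity lets `sort-continuous` compare the runs on two
  -- trees.
  Forces : ∀ {m} → ℕ → ℕ → Stage m → Set
  Forces j N s = ∀ {t} → SizeWithin (k + 1) t → s ⊑ t → ∀ {i v} → N ≤ i → Outputs t i v → j ≤ v

  ForcedAbove : ∀ {m} → ℕ → Stage m → Set
  ForcedAbove {m} j s = ∃ λ (s′ : Stage m) → s ≼ s′ × ∃ λ N → Forces j N s′

  InfinitelyManyOutputs : Tree → ℕ → Set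
  InfinitelyManyOutputs t j = ∀ M → ∃ λ i → M ≤ i × Outputs t i j

  module _ {m} (1≤m : 1 ≤ m) {s : Stage m} {j N} (forced : Forces j N s)
           (¬more : ¬ ForcedAbove (suc j) s) where

    -- As `s₀` is not `suc j`-forcing, some small tree above it has a late output below `suc j`,
    -- which forcing makes equal to `j`. That output uses finitely much of the tree, and a graft
    -- with one path per cone preserves this part.
    refine : ∀ {s₀} → s ≼ s₀ → ∀ M → ∃ λ s₁ → s₀ ≼ s₁ × level s₀ < level s₁ ×
      ∃ λ i → M ≤ i × ∀ {t} → s₁ ⊑ t → Outputs t i j
    refine {s₀} s≼s₀ M
      -- Beyond `M` to get arbitrarily late outputs, beyond `N` so that `forced` applies.
      with em {∃ λ t → SizeWithin (k + 1) t × s₀ ⊑ t ×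
             ∃ λ i → ∃ λ v → M ⊔ N ≤ i × Outputs t i v × v < suc j}
    ... | no none = contradiction
      (s₀ , s≼s₀ , M ⊔ N , λ {t} small s₀⊑t {i} {v} ≤i out →
        ≮⇒≥ λ v<1+j → none (t , small , s₀⊑t , i , v , ≤i , out , v<1+j)) ¬more
    ... | yes (t , small , s₀⊑t , i , v , ≤i , out , v<1+j)
      with ≤-antisym (s≤s⁻¹ v<1+j) (forced small (≼-⊑ s≼s₀ s₀⊑t) (≤-trans (m≤n⊔m M N) ≤i) out)
         | finite-use out
    ... | refl | u , use =
      stage
      , record { level-≤ = ≤-trans level≤L (n≤1+n L)
               ; tree-≈  = ≈ᵗ-trans (proj₁ s₀⊑t) (≈ᵗ-mono level≤L graft-≈)
               ; node-≈  = xs≈ }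
      , s≤s level≤L , i , ≤-trans (m≤m⊔n M N) ≤i
      , λ stage⊑t → use (encode-≈[] u (≈ᵗ-mono (m≤m⊔n u (level s₀)) (stage-≈ stage⊑t)))
      where
      L : ℕ
      L = u ⊔ level s₀
      level≤L : level s₀ ≤ L
      level≤L = m≤n⊔m u (level s₀)
      xs : Fin m → Point
      xs i = proj₁ (proj₂ s₀⊑t i)
      xs≈ : ∀ i → xs i ≈[ level s₀ ] node s₀ i
      xs≈ i = proj₂ (proj₂ (proj₂ s₀⊑t i))
      open Graft t L xs (λ i → proj₁ (proj₂ (proj₂ s₀⊑t i)) L) (λ {i} {j} eq → separated s₀
        (≈[]-trans (≈[]-sym (xs≈ i)) (≈[]-trans (≈[]-mono (≤-trans level≤L (n≤1+n L)) eq) (xs≈ j))))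

    stages : ℕ → ∃ (s ≼_)
    stages zero    = s , ≼-refl
    -- Step `r` asks for a position from `r` on, so the positions with output `j` are unbounded.
    stages (suc r) = let s₁ , s₀≼s₁ , _ = refine (proj₂ (stages r)) r in s₁ , ≼-trans (proj₂ (stages r)) s₀≼s₁

    abstract
      generic : ∃ λ t → ∃ λ (xs : Fin m → Point) → Enumerates t xs × s ⊑ t ×
        (∀ i → xs i ≈[ level s ] node s i) × InfinitelyManyOutputs t j
      generic = limit , branch , limit-enumerates , limit-⊒ 0 , branch-≈ 0 , λ M →
        let _ , _ , _ , i , M≤i , out = refine (proj₂ (stages M)) M in i , M≤i , out (limit-⊒ (suc M))
        where
        open Limit (proj₁ ∘ stages)
          (λ r → proj₁ (proj₂ (refine (proj₂ (stages r)) r)))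
          (λ r → proj₁ (proj₂ (proj₂ (refine (proj₂ (stages r)) r)))) 1≤m

  abstract
    -- Moduli compose backwards: `K` reads `u` entries of its oracle, the sorted entries among them
    -- depend on `M` outputs of `H`, and those on `v` entries of the name. Beyond that depth `t′`
    -- may have other paths than `t`, as long as it is small and lies above `s`.
    commit : ∀ {m} {s : Stage m} {j N} → Forces j N s → ∀ {t} → SizeWithin (k + 1) t → s ⊑ t →
      InfinitelyManyOutputs t j → (R : Run t) → ∀ l →
      ∃ λ L → ∀ {t′} → SizeWithin (k + 1) t′ → s ⊑ t′ → t ≈ᵗ[ L ] t′ → (R′ : Run t′) →
            answer R ≈[ l ] answer R′
    commit {s = s} {j} {N} forced {t} small s⊑t inf R l
      with uniform-bound (λ n u → ∀ {q} → ⟨ encode t , toℕ ∘ sorted R ⟩ ≈[ u ] q →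
             q ⊩ eᴷ · n ∷ [] ⇓ toℕ (answer R n))
             (λ u≤v use q≈ → use (≈[]-mono u≤v q≈)) l (λ n _ → finite-use (answer-runs R n))
    ... | u , K-use
      with sort-continuous j N (λ i N≤i → forced small s⊑t N≤i (input-runs R i))
             (λ M → let i , M≤i , out = inf M in i , M≤i , deterministic (input-runs R i) out) (isSort R) u
    ... | M , sort-use
      with uniform-bound (λ n v → ∀ {p} → encode t ≈[ v ] p → p ⊩ eᴴ · n ∷ [] ⇓ toℕ (input R n))
             (λ v≤w use p≈ → use (≈[]-mono v≤w p≈)) M (λ n _ → finite-use (input-runs R n))
    ... | v , H-use = u ⊔ v , agree
      where
      agree : ∀ {t′} → SizeWithin (k + 1) t′ → s ⊑ t′ → t ≈ᵗ[ u ⊔ v ] t′ → (R′ : Run t′) →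
            answer R ≈[ l ] answer R′
      agree small′ s⊑t′ t≈t′ R′ n n<l = toℕ-injective (deterministic
        (K-use n n<l (⟨,⟩-≈[] u (encode-≈[] u (≈ᵗ-mono (m≤m⊔n u v) t≈t′))
          (λ i i<u → cong toℕ (sorted-≈ i i<u))))
        (answer-runs R′ n))
        where
        input-≈ : input R ≈[ M ] input R′
        input-≈ i i<M = toℕ-injective (deterministic
          (H-use i i<M (encode-≈[] v (≈ᵗ-mono (m≤n⊔m u v) t≈t′))) (input-runs R′ i))
        sorted-≈ : sorted R ≈[ u ] sorted R′
        sorted-≈ = sort-use input-≈ (λ i N≤i → forced small′ s⊑t′ N≤i (input-runs R′ i)) (isSort R′)

  advance : ∀ {m j} → 1 ≤ m → suc m ≤ k + 1 → (∃ λ (s : Stage m) → ∃ λ N → Forces j N s) →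
    ∃ λ (s : Stage (suc m)) → ∃ λ N → Forces (suc j) N s
  advance {suc m} {j} 1≤m m<K (s , N , forced) with em {ForcedAbove (suc j) s}
  -- Any cone would do; cone `zero` is split at the level of `s′`.
  ... | yes (s′ , _ , N′ , forced′) = stage , N′ , λ small stage⊑t →
    forced′ small (graft-stage-⊑ s′ (tree s′) ≈ᵗ-refl ≤-refl (λ i → suc i , λ _ _ → refl) stage⊑t)
    where
    open Graft (tree s′) (level s′) (split (node s′) zero (level s′))
      (λ a → ∈[]-resp (tree s′) (≈[]-sym (split-≈ (node s′) zero (level s′) a)) (node∈ s′ (parent zero a)))
      (λ {i} {j} → split-separated zero (separated s′) {i} {j})
  ... | no ¬more₁
    with generic 1≤m forced ¬more₁
  ... | t₁ , xs , enum₁ , s⊑t₁ , xs≈ , inf₁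
    with (suc m , xs , 1≤m , ≤-trans (n≤1+n (suc m)) m<K , enum₁)
  ... | small₁ with run small₁
  -- The first `level s` bits of the answer reveal its cone, so this precision commits `K` to cone
  -- `i`.
  ... | R₁ with complete enum₁ (answer∈ R₁) | commit {s = s} {N = N} forced small₁ s⊑t₁ inf₁ R₁ (level s)
  ... | i , answer₁≗ | L₁ , commit₁ = result (em {ForcedAbove (suc j) stage₁})
    where
    L : ℕ
    -- The twins part only at bit `L`, too late to disturb the first commitment.
    L = L₁ ⊔ level s
    level≤L : level s ≤ L
    level≤L = m≤n⊔m L₁ (level s)

    xs-separated : Separated (level s) xs
    xs-separated {i} {j} eq = separated s (≈[]-trans (≈[]-sym (xs≈ i)) (≈[]-trans eq (xs≈ j)))

    ys₀ : Fin (suc (suc m)) → Point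
    ys₀ = split xs i L

    module G₁ = Graft t₁ L ys₀
      (λ a → ∈[]-resp t₁ (≈[]-sym (split-≈ xs i L a)) (sound enum₁ (parent i a) L))
      (λ {a} {b} → split-separated i (λ eq → xs-separated (≈[]-mono level≤L eq)) {a} {b})

    stage₁ : Stage (suc (suc m))
    stage₁ = G₁.stage

    s⊑ : ∀ {t} → stage₁ ⊑ t → s ⊑ t
    s⊑ = graft-stage-⊑ s t₁ (proj₁ s⊑t₁) level≤L λ i → suc i , xs≈ i

    forced₁ : Forces j N stage₁
    forced₁ small stage₁⊑t = forced small (s⊑ stage₁⊑t)

    result : Dec (ForcedAbove (suc j) stage₁) → ∃ λ (s : Stage (suc (suc m))) → ∃ λ N → Forces (suc j) N s
    result (yes (s′ , _ , N′ , forced′)) = s′ , N′ , forced′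
    result (no ¬more₂) with generic (s≤s z≤n) forced₁ ¬more₂
    ... | t₂ , ys , enum₂ , stage₁⊑t₂ , ys≈ , inf₂
      with (suc (suc m) , ys , s≤s z≤n , m<K , enum₂)
    ... | small₂ with run small₂
    -- At precision `suc L` the answer tells the twins apart. The commitment is relative to `s`, not
    -- `stage₁`, because a tree without one twin is still above `s` but not above `stage₁`.
    ... | R₂ with complete enum₂ (answer∈ R₂)
                | commit {s = s} {N = N} forced small₂ (s⊑ stage₁⊑t₂) inf₂ R₂ (suc L)
    ... | b , answer₂≗ | L₂ , commit₂ = contradiction (sym b≡) (Fin.punchInᵢ≢i b e)
      where
      ys-parent : ∀ a → ys a ≈[ level s ] xs (parent i a)
      ys-parent a = ≈[]-mono level≤L (≈[]-trans (≈[]-mono (n≤1+n L) (ys≈ a)) (split-≈ xs i L a))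

      -- `t₂` agrees with `t₁` far enough for the first commitment, so `b` is one of the twins over
      -- `i`.
      b↦i : parent i b ≡ i
      b↦i = xs-separated (≈[]-trans (≈[]-sym (ys-parent b)) (≈[]-trans
        (λ n _ → sym (answer₂≗ n)) (≈[]-trans
        (≈[]-sym (commit₁ small₂ (s⊑ stage₁⊑t₂) (≈ᵗ-mono (m≤m⊔n L₁ (level s)) (G₁.stage-≈ stage₁⊑t₂)) R₂))
        (λ n _ → answer₁≗ n))))

      ys-separated : Separated (suc L) ys
      ys-separated {a} {c} eq = separated stage₁ (≈[]-trans (≈[]-sym (ys≈ a)) (≈[]-trans eq (ys≈ c)))

      L′ : ℕ
      L′ = L₂ ⊔ suc L
      L<L′ : suc L ≤ L′
      L<L′ = m≤n⊔m L₂ (suc L)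

      -- Every path of `t₂` except the answer `ys b` is continued, and depth `L₂` is kept so that
      -- the second commitment applies.
      module G₂ = Graft t₂ L′ (ys ∘ punchIn b) (λ e → sound enum₂ (punchIn b e) L′)
        (λ {e} {e′} eq → Fin.punchIn-injective b e e′ (ys-separated (≈[]-mono (≤-trans L<L′ (n≤1+n L′)) eq)))

      small₃ : SizeWithin (k + 1) G₂.graft
      small₃ = suc m , ys ∘ punchIn b , s≤s z≤n , ≤-trans (n≤1+n (suc m)) m<K , G₂.graft-enumerates

      s⊑t₃ : s ⊑ G₂.graft
      s⊑t₃ = ⊑-graft s t₂ (proj₁ (s⊑ stage₁⊑t₂)) (≤-trans level≤L (≤-trans (n≤1+n L) L<L′)) λ a →
        let e , e↦a = removing-twin-covers i b b↦i a in
        e , ≈[]-trans (ys-parent (punchIn b e)) (subst (λ c → xs c ≈[ level s ] node s a) (sym e↦a) (xs≈ a))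

      R₃ : Run G₂.graft
      R₃ = run small₃

      e : Fin (suc m)
      e = proj₁ (complete G₂.graft-enumerates (answer∈ R₃))

      -- The commitment makes the new answer agree with `ys b` up to `suc L`, yet it is one of the
      -- surviving paths.
      b≡ : b ≡ punchIn b e
      b≡ = ys-separated (≈[]-trans (λ n _ → sym (answer₂≗ n)) (≈[]-trans
        (commit₂ small₃ s⊑t₃ (≈ᵗ-mono (m≤m⊔n L₂ (suc L)) G₂.graft-≈) R₃)
        (λ n _ → proj₂ (complete G₂.graft-enumerates (answer∈ R₃)) n)))

  forcing : ∀ j → j ≤ k → ∃ λ (s : Stage (suc j)) → ∃ λ N → Forces j N s
  -- Outputs are at least 0 anyway, so a single cone around the zero path will do.
  forcing zero    _   = stage , 0 , λ _ _ _ _ → z≤n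
    where
    root : Fin 1 → Point
    root _ _ = zero
    root-separated : Separated 1 root
    root-separated {zero} {zero} _ = refl
    open Graft full 0 root (λ _ → tt) (λ {i} {j} → root-separated {i} {j})
  forcing (suc j) j<k =
    advance (s≤s z≤n) (subst (suc (suc j) ≤_) (+-comm 1 k) (s≤s j<k)) (forcing j (<⇒≤ j<k))

  -- Continuing each of the `k + 1` nodes by one path gives an admissible tree, whose output at `N`
  -- would be at least `k` although it comes from `Fin k`.
  impossible : ∀ {A : Set} → A
  impossible with forcing k ≤-refl
  ... | s , N , forced = contradiction
    (forced small (⊑-graft s (tree s) ≈ᵗ-refl ≤-refl (λ i → i , λ _ _ → refl)) ≤-refl
      (input-runs (run small) N))
    (<⇒≱ (toℕ<n (input (run small) N)))
    where
    open Graft (tree s) (level s) (node s) (node∈ s) (λ eq → separated s (≈[]-mono (n≤1+n (level s)) eq))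
    small : SizeWithin (k + 1) graft
    small = suc k , node s , s≤s z≤n , ≤-reflexive (+-comm 1 k) , graft-enumerates

theorem20 : ExcludedMiddle 0ℓ → ∀ (k : ℕ) → k ≥ 1 → ¬ (C♯≤ (k + 1) ≤W Sort k)
theorem20 em k _ (H , K , H-computable , K-computable , reduces) =
  Reduction.impossible em k H K H-computable K-computable (reduces (sortFun k) (sortFun⊢Sort k))
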